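{- Let $T$ be a tree of diameter $5$ with vertex set $V(T)=\{v_1,v_2,\ldots,v_n\}$, labelled so that $v_1$ and $v_2$ are its two central vertices, let $s_1,s_2,\ldots,s_n$ be integers with $s_i\ge 2$ for all $i=1,\ldots,n$, and let $G:=T(s_1,s_2,\ldots,s_n)$ be the corresponding vertex-multiplication. For $k=1,2$ let $NL_k$ be the set of vertices of $T$ that are neighbours of $v_k$, different from $v_{3-k}$, and not end-vertices (leaves) of $T$, and let $m_k:=\min\{s_u \mid u\in NL_k\}$, where $s_u$ denotes the integer $s_i$ with $u=v_i$. Then the following hold. (1) If $s_i\ge 3$ for some $i\in\{1,2\}$, then $G\in\mathscr{C}_0$. (2) If $m_1\ge 4$ and $m_2\ge 4$, then $G\in\mathscr{C}_0$. (3) If $s_1=s_2=2$ and $2\le m_i\le 3$ for some $i\in\{1,2\}$, then $G\in\mathscr{C}_0$ if and only if $|NL_k|=1$ for some $k\in\{1,2\}$.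
   Context: Graphs are finite, with no loops or parallel edges. For a connected graph $G$ with vertex set $\{v_1,\ldots,v_n\}$ and positive integers $s_1,\ldots,s_n$, the $G$ vertex-multiplication $G(s_1,\ldots,s_n)$ is the graph with vertex set $\bigcup_{i=1}^n V_i$, where the $V_i$ are pairwise disjoint sets with $|V_i|=s_i$, in which $x\in V_i$ and $y\in V_j$ are adjacent if and only if $i\ne j$ and $v_iv_j\in E(G)$. An orientation of a graph is a digraph obtained by assigning a direction to every edge; it is strong if every two vertices are mutually reachable by directed paths. In a graph or digraph, the distance from $v$ to $x$ is the length of a shortest (directed) path from $v$ to $x$ ($\infty$ if none exists), and the diameter $d(\cdot)$ is the maximum of the distances over all ordered pairs of vertices. For a connected bridgeless graph $G$, the orientation number is $\bar d(G):=\min\{d(D)\mid D \text{ is a strong orientation of } G\}$. For a connected parent graph $G$ of order $n\ge 3$ and $s_i\ge 2$ for all $i$, one writes $G(s_1,\ldots,s_n)\in\mathscr{C}_j$ if $\bar d(G(s_1,\ldots,s_n))=d(G)+j$, for $j=0,1,2$. Thus for a tree $T$ of diameter $5$, $T(s_1,\ldots,s_n)\in\mathscr{C}_0$ means $\bar d(T(s_1,\ldots,s_n))=5$. A tree of diameter $5$ has exactly two central vertices, i.e. vertices of eccentricity equal to the radius $3$, and they are adjacent. The sets $NL_1,NL_2$ are always nonempty, so $m_1,m_2$ are well defined. -}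

module Defs where

open import Level using (0ℓ)
open import Data.Nat using (ℕ; zero; suc; _+_; _≤_; _≟_)
open import Data.Fin as Fin using (Fin; opposite)
open import Data.Fin.Subset using (Subset; _-_; _─_; ∣_∣)
open import Data.List using (List; []; _∷_)
open import Data.List.Relation.Unary.Unique.Propositional using (Unique)
open import Data.Product using (Σ; ∃; ∃₂; _×_; _,_; proj₁)
open import Data.Sum using (_⊎_)
open import Data.Vec using (tabulate)
open import Relation.Binary.Core using (Rel)
open import Relation.Binary.Definitions
  using (Symmetric; Asymmetric; Decidable; Irreflexive)
open import Relation.Binary.PropositionalEquality using (_≡_; _≢_; ≢-sym; cong)
open import Relation.Nullary using (¬_; does)
open import Relation.Nullary.Decidable using (¬?; _×-dec_)
open import Relation.Unary using (Pred)

IsMinimum : ∀ {ℓ} → Pred ℕ ℓ → ℕ → Set ℓ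
IsMinimum P m = P m × (∀ k → P k → m ≤ k)

-- Finiteness is a property of the vertex type: the graphs of interest live on
-- Fin n and on Σ (Fin n) (λ i → Fin (s i)).
record Graph (V : Set) : Set₁ where
  field
    Adj    : Rel V 0ℓ
    adj?   : Decidable Adj
    sym    : Symmetric Adj
    irrefl : Irreflexive _≡_ Adj

open Graph public

-- The notions in this module apply to a graph (R = Adj G) and to a digraph
-- (R = its arc relation) alike.
module _ {V : Set} (R : Rel V 0ℓ) where

  data Walk : ℕ → V → V → Set where
    []  : ∀ {x} → Walk zero x x
    _∷_ : ∀ {k x y z} → R x y → Walk k y z → Walk (suc k) x z

  vertices : ∀ {k x y} → Walk k x y → List V
  vertices {x = x} []      = x ∷ []
  vertices {x = x} (_ ∷ w) = x ∷ vertices w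

  Path : ℕ → V → V → Set
  Path k x y = Σ (Walk k x y) λ w → Unique (vertices w)

  Connected : Set
  Connected = ∀ x y → ∃ λ k → Path k x y

  -- An infinite distance is represented by the absence of any k with
  -- Distance x y k; eccentricities and diameters below are finite ones.
  Distance : V → V → ℕ → Set
  Distance x y = IsMinimum λ k → Path k x y

  IsEccentricity : V → ℕ → Set
  IsEccentricity v d =
    (∀ y → ∃ λ k → Distance v y k × k ≤ d) × ∃ λ y → Distance v y d

  IsDiameter : ℕ → Set
  IsDiameter d =
    (∀ x y → ∃ λ k → Distance x y k × k ≤ d) × ∃₂ λ x y → Distance x y d

module _ {V : Set} (G : Graph V) where

  IsRadius : ℕ → Set
  IsRadius = IsMinimum λ d → ∃ λ v → IsEccentricity (Adj G) v d

  IsCentral : V → Set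
  IsCentral v = ∃ λ r → IsRadius r × IsEccentricity (Adj G) v r

  -- A cycle is a path with at least two edges together with an edge joining
  -- its ends.
  Acyclic : Set
  Acyclic = ∀ {k x y} → 2 ≤ k → Path (Adj G) k x y → ¬ Adj G y x

  IsTree : Set
  IsTree = Connected (Adj G) × Acyclic

  record Orientation : Set₁ where
    field
      Arc     : Rel V 0ℓ
      arc⇒adj : ∀ {x y} → Arc x y → Adj G x y
      adj⇒arc : ∀ {x y} → Adj G x y → Arc x y ⊎ Arc y x
      asym    : Asymmetric Arc

  open Orientation public

  -- Connected (Arc D) quantifies over ordered pairs, so it says that D is
  -- strong.
  IsOrientationNumber : ℕ → Set₁
  IsOrientationNumber = IsMinimum λ d →
    Σ Orientation λ D → Connected (Arc D) × IsDiameter (Arc D) d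

_⟨_⟩ : ∀ {n} → Graph (Fin n) → (s : Fin n → ℕ) → Graph (Σ (Fin n) λ i → Fin (s i))
(G ⟨ s ⟩) .Adj  (i , _) (j , _) = i ≢ j × Adj G i j
(G ⟨ s ⟩) .adj? (i , _) (j , _) = ¬? (i Fin.≟ j) ×-dec adj? G i j
(G ⟨ s ⟩) .sym (i≢j , e) = ≢-sym i≢j , sym G e
(G ⟨ s ⟩) .irrefl p (i≢j , _) = i≢j (cong proj₁ p)

-- G ⟨ s ⟩ ∈ 𝒞_j.
InClass : ℕ → ∀ {n} → Graph (Fin n) → (Fin n → ℕ) → Set₁
InClass j G s =
  ∃ λ d → IsDiameter (Adj G) d × IsOrientationNumber (G ⟨ s ⟩) (d + j)

module _ {n} (G : Graph (Fin n)) where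

  neighbours : Fin n → Subset n
  neighbours v = tabulate λ u → does (adj? G v u)

  leaves : Subset n
  leaves = tabulate λ v → does (∣ neighbours v ∣ ≟ 1)

  -- For c enumerating v₁, v₂ this is NL_k; opposite k is the index 3 - k.
  NL : (Fin 2 → Fin n) → Fin 2 → Subset n
  NL c k = neighbours (c k) - c (opposite k) ─ leaves

{-# OPTIONS --safe #-}
-- A vertex of T is a centre c k, an inner vertex (one in NL_k), a pendant vertex
-- at a centre, or a far vertex attached to an inner one.
--
-- Existence: colour the copies of every vertex with a few colours and let the
-- direction of an arc depend only on the places and colours of its ends. Any two
-- copies then lie in the image of a homomorphism from one fixed small digraph, in
-- which walks of length at most 5 are found by computation.
--
-- Non-existence: if s₁ = s₂ = 2 and some inner vertex has at most three copies,
-- a copy x of a far vertex attached to it has, up to reversing all arcs, a single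
-- out-neighbour p. The distances 4 in T are attained by walks of length 4 in any
-- orientation of diameter 5, and if there are two inner vertices on either side
-- these geodesics leave no room for one returning to x.
module Submission where

open import Defs
open import Level using (0ℓ)
open import Data.Bool using (Bool; true; false; not; _∧_; _∨_) renaming (T to True)
import Data.Bool.Properties as Boolₚ
open import Data.Bool.ListAction using (any; all)
open import Data.Nat as ℕ
  using (ℕ; zero; suc; _+_; _≤_; _<_; z≤n; s≤s; _≡ᵇ_; _<?_; _/_; _%_)
import Data.Nat.Properties as ℕₚ
open import Data.Fin as Fin using (Fin; zero; suc; opposite; toℕ; fromℕ<)
open import Data.Fin.Patterns using (0F; 1F; 2F)
import Data.Fin.Properties as Finₚ
open import Data.Fin.Subset using (Subset; _∈_; _∉_; _⊆_; _─_; _-_; ⁅_⁆; ∣_∣)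
import Data.Fin.Subset.Properties as Subsetₚ
open import Data.List using (List; []; _∷_; _++_; map; concatMap; filter; allFin)
import Data.List.Membership.Propositional as List
import Data.List.Membership.Propositional.Properties as Listₚ
open import Data.List.Relation.Unary.All as All using (All; []; _∷_)
import Data.List.Relation.Unary.All.Properties as Allₚ
open import Data.List.Relation.Unary.Any using (here; there)
import Data.List.Relation.Unary.Any.Properties as Anyₚ
open import Data.List.Relation.Unary.AllPairs using ([]; _∷_)
open import Data.List.Relation.Unary.Unique.Propositional using (Unique)
open import Data.Vec using (tabulate; _∷_; here; there)
import Data.Vec.Properties as Vecₚ
open import Data.Product using (∃; ∃₂; Σ; _×_; _,_; proj₁; proj₂)
import Data.Product.Properties as Prodₚ
open import Data.Sum as Sum using (_⊎_; inj₁; inj₂)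
open import Data.Empty using (⊥; ⊥-elim)
open import Data.Unit using (tt)
open import Function using (_∘_; Equivalence)
open import Function.Bundles using (_⇔_; mk⇔)
open import Relation.Binary.Core using (Rel)
open import Relation.Binary.Definitions using (DecidableEquality; Decidable)
open import Relation.Binary.PropositionalEquality as ≡
  using (_≡_; _≢_; refl; cong; cong₂; subst; ≢-sym)
open import Relation.Nullary using (¬_; Dec; yes; no; does)
open import Relation.Nullary.Decidable using (_×-dec_; map′; ¬?; T?; dec-true)

-- Minima, walks, paths and distances.

Within5 : ∀ {V : Set} → Rel V 0ℓ → Set
Within5 R = ∀ x y → ∃ λ k → k ≤ 5 × Walk R k x y

least : ∀ {P : ℕ → Set} → (∀ k → Dec (P k)) → ∀ k → P k → ∃ (IsMinimum P)
least P? zero    p = 0 , p , λ _ _ → z≤n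
least P? (suc k) p with P? 0
... | yes p₀ = 0 , p₀ , λ _ _ → z≤n
... | no ¬p₀ with least (λ j → P? (suc j)) k p
...   | l , pₗ , min = suc l , pₗ , λ where
        zero    p₀ → ⊥-elim (¬p₀ p₀)
        (suc j) pⱼ → s≤s (min j pⱼ)

minimum-unique : ∀ {P : ℕ → Set} {k l} → IsMinimum P k → IsMinimum P l → k ≡ l
minimum-unique (p , k≤) (q , l≤) = ℕₚ.≤-antisym (k≤ _ q) (l≤ _ p)

module _ {V : Set} {R : Rel V 0ℓ} where

  snoc : ∀ {k x y z} → Walk R k x y → R y z → Walk R (suc k) x z
  snoc []      e = e ∷ []
  snoc (f ∷ w) e = f ∷ snoc w e

  start : ∀ {k x y} {P : V → Set} (w : Walk R k x y) → All P (vertices R w) → P x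
  start []      (p ∷ _) = p
  start (_ ∷ _) (p ∷ _) = p

  end∈ : ∀ {k x y} (w : Walk R k x y) → y List.∈ vertices R w
  end∈ []      = here refl
  end∈ (_ ∷ w) = there (end∈ w)

  prefix : ∀ {k x y z} (w : Walk R k x y) → Unique (vertices R w) → z List.∈ vertices R w →
    ∃ λ l → Σ (Walk R l x z) λ v → Unique (vertices R v) ×
      (∀ {P : V → Set} → All P (vertices R w) → All P (vertices R v))
  prefix []      u       (here refl) = 0 , [] , u , λ ps → ps
  prefix (e ∷ w) _       (here refl) = 0 , [] , [] ∷ [] , λ where (p ∷ _) → p ∷ []
  prefix (e ∷ w) (x∉ ∷ u) (there i) with prefix w u i
  ... | l , v , uᵥ , sub = suc l , e ∷ v , sub x∉ ∷ uᵥ , λ where (p ∷ ps) → p ∷ sub ps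

  suffix : ∀ {k x y z} (w : Walk R k x y) → Unique (vertices R w) → z List.∈ vertices R w →
    ∃ λ l → l ≤ k × Path R l z y
  suffix []      u        (here refl) = 0 , z≤n , [] , u
  suffix (e ∷ w) u        (here refl) = _ , ℕₚ.≤-refl , e ∷ w , u
  suffix (e ∷ w) (_ ∷ u) (there i) with suffix w u i
  ... | l , l≤k , path = l , ℕₚ.m≤n⇒m≤1+n l≤k , path

  module _ (_≟_ : DecidableEquality V) where

    open import Data.List.Membership.DecPropositional _≟_ using (_∈?_)

    shorten : ∀ {k x y} → Walk R k x y → ∃ λ l → l ≤ k × Path R l x y
    shorten [] = 0 , z≤n , [] , [] ∷ []
    shorten {x = x} (e ∷ w) with shorten w
    ... | l , l≤k , v , u with x ∈? vertices R v
    ...   | no x∉ = suc l , s≤s l≤k , e ∷ v , Allₚ.¬Any⇒All¬ _ x∉ ∷ u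
    ...   | yes x∈ with suffix v u x∈
    ...     | j , j≤l , path = j , ℕₚ.m≤n⇒m≤1+n (ℕₚ.≤-trans j≤l l≤k) , path

    module _ (R? : Decidable R)
             (any? : ∀ {P : V → Set} → (∀ v → Dec (P v)) → Dec (∃ P)) where

      walk? : ∀ k x y → Dec (Walk R k x y)
      walk? zero    x y = map′ (λ where refl → []) (λ where [] → refl) (x ≟ y)
      walk? (suc k) x y = map′ (λ where (_ , e , w) → e ∷ w) (λ where (e ∷ w) → _ , e , w)
        (any? λ z → R? x z ×-dec walk? k z y)

      -- A shortest walk is a path, since shortening it cannot lose a step. Searching among walks
      -- rather than paths makes each length decidable by recursion.
      distance : ∀ {k x y} → Walk R k x y → ∃ λ l → Distance R x y l × l ≤ k
      distance {k} {x} {y} w with least (λ j → walk? j x y) k w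
      ... | l , v , min with shorten v
      ...   | j , j≤l , v′ , u with ℕₚ.≤-antisym j≤l (min j v′)
      ...     | refl = l , ((v′ , u) , λ i p → min i (proj₁ p)) , min k w

-- Trails in acyclic graphs.

module Trails {V : Set} (_≟_ : DecidableEquality V) (G : Graph V) (acyclic : Acyclic G) where

  -- Trail k p x y: a walk without backtracking which, coming from p, does not
  -- return to p in its first step. With p = x this is no condition.
  data Trail : ℕ → V → V → V → Set where
    []   : ∀ {p x} → Trail zero p x x
    step : ∀ {k p x y z} → Adj G x z → z ≢ p → Trail k x z y → Trail (suc k) p x y

  adj⇒≢ : ∀ {x y} → Adj G x y → x ≢ y
  adj⇒≢ e x≡y = irrefl G x≡y e

  walk : ∀ {k p x y} → Trail k p x y → Walk (Adj G) k x y
  walk []           = []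
  walk (step e _ t) = e ∷ walk t

  -- Cut at its first return to `x`, the rest of the trail would be a path that the edge leaving `x`
  -- closes to a cycle; not backtracking gives that path at least two edges.
  path : ∀ {k p x y} (t : Trail k p x y) → Unique (vertices (Adj G) (walk t))
  path [] = [] ∷ []
  path {x = x} (step e _ t) = Allₚ.¬Any⇒All¬ _ (escapes e t (path t)) ∷ path t
    where
    escapes : ∀ {k z y} → Adj G x z → (t : Trail k x z y) → Unique (vertices (Adj G) (walk t)) →
      ¬ (x List.∈ vertices (Adj G) (walk t))
    escapes e []            _        (here refl) = irrefl G refl e
    escapes e (step _ _ _)  _        (here refl) = irrefl G refl e
    escapes e (step e′ z≢x t) (z∉ ∷ u) (there i) with prefix (walk t) u i
    ... | zero  , []    , _ , _ = z≢x refl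
    ... | suc l , v , uᵥ , sub  = acyclic (s≤s (s≤s z≤n)) (e′ ∷ v , sub z∉ ∷ uᵥ) e

  fromPath : ∀ {k x y} → Path (Adj G) k x y → Trail k x x y
  fromPath ([]    , _)       = []
  fromPath (e ∷ w , x∉ ∷ u) = step e (≢-sym (start w x∉)) (go w u x∉)
    where
    go : ∀ {k p x y} (w : Walk (Adj G) k x y) → Unique (vertices (Adj G) w) →
      All (p ≢_) (vertices (Adj G) w) → Trail k p x y
    go []      _        _        = []
    go (e ∷ w) (x∉ ∷ u) (_ ∷ p∉) = step e (≢-sym (start w p∉)) (go w u x∉)

  no-closed : ∀ {k p x} → ¬ Trail (suc k) p x x
  no-closed (step e ne t) with path (step e ne t)
  ... | x∉ ∷ _ = All.lookup x∉ (end∈ (walk t)) refl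

  -- The reversed trail arrives at `x` from some `c` other than `p`, because the trail did not start
  -- towards `p` (for an empty trail `x` itself serves as `c`). Hence a continuation that starts
  -- towards `p` does not backtrack.
  reverseOnto : ∀ {k l p x y z} → p ≢ x → Trail k p x y →
    (∀ c → c ≢ p → Trail l c x z) → ∃ λ c → Trail (k + l) c y z
  reverseOnto p≢x []            t = _ , t _ (≢-sym p≢x)
  reverseOnto {suc k} {l} {y = y} {z} p≢x (step e ne s) t
    with reverseOnto (adj⇒≢ e) s (λ c c≢x → step (sym G e) (≢-sym c≢x) (t _ ne))
  ... | c , r = c , subst (λ m → Trail m c y z) (ℕₚ.+-suc k l) r

  -- Where the two trails part, reversing one onto the other yields a closed trail of positive
  -- length, against `no-closed`.
  length-unique : ∀ {k l p q x y} → Trail k p x y → Trail l q x y → k ≡ l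
  length-unique []              []              = refl
  length-unique []              t@(step _ _ _)  = ⊥-elim (no-closed t)
  length-unique s@(step _ _ _)  []              = ⊥-elim (no-closed s)
  length-unique {suc k} {y = y} (step {z = a} e ne s) (step {z = b} f nf t) with a ≟ b
  ... | yes refl = cong suc (length-unique s t)
  ... | no a≢b with reverseOnto (adj⇒≢ e) s
                      (λ c c≢x → step (sym G e) (≢-sym c≢x) (step f (≢-sym a≢b) t))
  ...   | c , r = ⊥-elim (no-closed (subst (λ m → Trail m c y y) (ℕₚ.+-suc k _) r))

  trail≤walk : ∀ {k d p x y} → Trail d p x y → Walk (Adj G) k x y → d ≤ k
  trail≤walk t w with shorten _≟_ w
  ... | l , l≤k , v = subst (_≤ _) (length-unique (fromPath v) t) l≤k

  distance≡length : ∀ {k d p x y} → Distance (Adj G) x y k → Trail d p x y → k ≡ d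
  distance≡length (v , _) t = length-unique (fromPath v) t

-- The centres of a tree of diameter 5.

maximiser : ∀ {n} (f : Fin n → ℕ) → Fin n → ∃ λ i → ∀ j → f j ≤ f i
maximiser {suc zero} f _ = 0F , λ where 0F → ℕₚ.≤-refl
maximiser {suc (suc n)} f _ with maximiser (λ j → f (suc j)) 0F
... | i , max with ℕₚ.≤-total (f 0F) (f (suc i))
...   | inj₁ f0≤ = suc i , λ where
          0F      → f0≤
          (suc j) → max j
...   | inj₂ ≤f0 = 0F , λ where
          0F      → ℕₚ.≤-refl
          (suc j) → ℕₚ.≤-trans (max j) ≤f0

diameter-unique : ∀ {V : Set} {R : Rel V 0ℓ} {d e} → IsDiameter R d → IsDiameter R e → d ≡ e
diameter-unique p q = ℕₚ.≤-antisym (below p q) (below q p)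
  where
  below : ∀ {d e} → IsDiameter _ d → IsDiameter _ e → d ≤ e
  below (_ , x , y , dxy) (all , _) with all x y
  ... | k , dk , k≤e rewrite minimum-unique dxy dk = k≤e

module Centres {n} (T : Graph (Fin n)) (tree : IsTree T) (diam : IsDiameter (Adj T) 5) where
  open Trails Fin._≟_ T (proj₂ tree)

  trail : ∀ x y → ∃ λ k → Trail k x x y
  trail x y with proj₁ tree x y
  ... | k , v = k , fromPath v

  trail≤5 : ∀ {k p x y} → Trail k p x y → k ≤ 5
  trail≤5 {x = x} {y} t with proj₁ diam x y
  ... | k , d , k≤5 = subst (_≤ 5) (distance≡length d t) k≤5

  -- The witness is the third vertex of a longest path. A trail leaving it forwards along that path
  -- extends the two edges before it; any other trail extends the three edges after it, read
  -- backwards. Both totals are at most 5.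
  within-3 : ∃ λ v → ∀ {k p y} → Trail k p v y → k ≤ 3
  within-3 with proj₂ diam
  ... | x , y , (v , _) with fromPath v
  ...   | step e₁ n₁ (step {z = a₂} e₂ n₂
            (step {z = a₃} e₃ n₃ (step e₄ n₄ (step e₅ n₅ [])))) =
    a₂ , bound
    where
    bound : ∀ {k p z} → Trail k p a₂ z → k ≤ 3
    bound [] = z≤n
    bound (step {z = z} e ne t) with z Fin.≟ a₃
    ... | yes refl = ℕₚ.+-cancelˡ-≤ 2 _ _ (trail≤5 (step e₁ n₁ (step e₂ n₂ (step e n₃ t))))
    ... | no z≢a₃  = ℕₚ.m≤n⇒m≤1+n (ℕₚ.+-cancelˡ-≤ 3 _ _ (trail≤5
                       (step (sym T e₅) (adj⇒≢ e₅) (step (sym T e₄) (≢-sym n₅)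
                         (step (sym T e₃) (≢-sym n₄) (step e z≢a₃ t))))))

  -- The radius is at most the eccentricity of the vertex from `within-3`; `maximiser` shows that
  -- this eccentricity is attained.
  central⇒short : ∀ {v} → IsCentral T v → ∀ {k p y} → Trail k p v y → k ≤ 3
  central⇒short (r , (_ , r≤) , far , _) {y = y} t with within-3
  ... | a , short with maximiser (λ y → proj₁ (proj₁ diam a y)) a
  ...   | z , max with far y
  ...     | k , d , k≤r =
    ℕₚ.≤-trans (subst (_≤ r) (distance≡length d t) k≤r) (ℕₚ.≤-trans (r≤ ecc (a , isEcc)) ecc≤3)
    where
    ecc : ℕ
    ecc = proj₁ (proj₁ diam a z)
    at-ecc : Distance (Adj T) a z ecc
    at-ecc = proj₁ (proj₂ (proj₁ diam a z))
    isEcc : IsEccentricity (Adj T) a ecc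
    isEcc = (λ y → proj₁ (proj₁ diam a y) , proj₁ (proj₂ (proj₁ diam a y)) , max y) , z , at-ecc
    ecc≤3 : ecc ≤ 3
    ecc≤3 with trail a z
    ... | _ , t′ = subst (_≤ 3) (≡.sym (distance≡length at-ecc t′)) (short t′)

  -- If the two centres were not adjacent, every vertex would be within
  -- distance 2 of the vertex next to u on the way to v.
  centres-adjacent : ∀ {u v} → u ≢ v →
    (∀ {k p y} → Trail k p u y → k ≤ 3) → (∀ {k p y} → Trail k p v y → k ≤ 3) → Adj T u v
  centres-adjacent {u} {v} u≢v shortᵤ shortᵥ with trail u v
  ... | _ , []                  = ⊥-elim (u≢v refl)
  ... | _ , step e _ []         = e
  ... | _ , step {z = b} e _ t@(step f nf t′) with proj₂ diam
  ...   | x , y , (_ , 5≤) = ⊥-elim (ℕₚ.<⇒≱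
            (s≤s (ℕₚ.+-mono-≤ (close (proj₂ (trail b x))) (close (proj₂ (trail b y)))))
            (5≤walk (walk (proj₂ (trail b x)) ʳ◅◅ walk (proj₂ (trail b y)))))
    where
    _ʳ◅◅_ : ∀ {k l x y z} → Walk (Adj T) k x y → Walk (Adj T) l x z → Walk (Adj T) (k + l) y z
    []      ʳ◅◅ w = w
    _ʳ◅◅_ {suc k} {l} {y = y} {z} (e ∷ v) w =
      subst (λ m → Walk (Adj T) m y z) (ℕₚ.+-suc k l) (v ʳ◅◅ (sym T e ∷ w))
    5≤walk : ∀ {k} → Walk (Adj T) k x y → 5 ≤ k
    5≤walk w with shorten Fin._≟_ w
    ... | l , l≤k , p = ℕₚ.≤-trans (5≤ l p) l≤k
    -- A trail away from `u` is extended by the edge from `u` to `b`; one towards `u` is extended by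
    -- the trail from `v` to `b`, which has at least one edge.
    close : ∀ {k p z} → Trail k p b z → k ≤ 2
    close [] = z≤n
    close (step {z = z} g ng r) with z Fin.≟ u
    ... | no z≢u = ℕₚ.+-cancelˡ-≤ 1 _ _ (shortᵤ (step e (≢-sym (adj⇒≢ e)) (step g z≢u r)))
    ... | yes refl with reverseOnto (adj⇒≢ f) t′
                          (λ c c≢b → step (sym T f) (≢-sym c≢b) (step g (≢-sym nf) r))
    ...   | _ , r′ = ℕₚ.+-cancelˡ-≤ 1 _ _ (ℕₚ.≤-trans (ℕₚ.m≤n+m _ _) (shortᵥ r′))

data Place : Set where
  centre inner pend far : Place

depth : Place → ℕ
depth centre = 0
depth inner  = 1
depth pend   = 1
depth far    = 2

≢⇒opposite : {k l : Fin 2} → k ≢ l → l ≡ opposite k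
≢⇒opposite {0F} {0F} k≢l = ⊥-elim (k≢l refl)
≢⇒opposite {0F} {1F} _   = refl
≢⇒opposite {1F} {0F} _   = refl
≢⇒opposite {1F} {1F} k≢l = ⊥-elim (k≢l refl)

-- Bounded search in a finite digraph.

module _ {A : Set} (arc : A → A → Bool) (nodes : List A) where

  successors : List A → List A
  successors S = filter (λ m → T? (any (λ l → arc l m) S)) nodes

  ball : ℕ → List A → List A
  ball zero    S = S
  ball (suc k) S = S ++ ball k (successors S)

  ball-sound : ∀ k S {m} → m List.∈ ball k S →
    ∃₂ λ l j → l List.∈ S × j ≤ k × Walk (λ x y → True (arc x y)) j l m
  ball-sound zero    S m∈ = _ , 0 , m∈ , z≤n , []
  ball-sound (suc k) S m∈ with Listₚ.∈-++⁻ S m∈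
  ... | inj₁ m∈S = _ , 0 , m∈S , z≤n , []
  ... | inj₂ m∈B with ball-sound k (successors S) m∈B
  ...   | l , j , l∈ , j≤k , w
          with List.find (Anyₚ.any⁻ _ S
                 (proj₂ (Listₚ.∈-filter⁻ (λ m → T? (any (λ l → arc l m) S)) {xs = nodes} l∈)))
  ...     | l′ , l′∈ , e = l′ , suc j , l′∈ , s≤s j≤k , e ∷ w

  -- The last arc is tested separately, so balls of radius 4 suffice. Every walk found has positive
  -- length, which loses nothing in `check`, where sources and targets lie in different groups.
  joined-within-5 : List A → List A → Bool
  joined-within-5 sources targets = all (λ n → reaches-all (ball 4 (n ∷ []))) sources
    where
    reaches-all : List A → Bool
    reaches-all S = all (λ m → any (λ l → arc l m) S) targets

  joined-sound : ∀ {sources targets} → True (joined-within-5 sources targets) →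
    ∀ {n m} → n List.∈ sources → m List.∈ targets →
    ∃ λ k → k ≤ 5 × Walk (λ x y → True (arc x y)) k n m
  joined-sound {sources} {targets} ok {n} n∈ m∈
    with List.find (Anyₚ.any⁻ _ (ball 4 (n ∷ []))
           (All.lookup (Allₚ.all⁺ _ targets (All.lookup (Allₚ.all⁺ _ sources ok) n∈)) m∈))
  ... | l , l∈ , e with ball-sound 4 (n ∷ []) l∈
  ...   | _ , _ , there () , _
  ...   | _ , j , here refl , j≤4 , w = suc j , s≤s j≤4 , snoc w e

-- Colour schemes and their templates.

True-not : ∀ b → True b → ¬ True (not b)
True-not true _ ()

True-or-not : ∀ b → True b ⊎ True (not b)
True-or-not true  = inj₁ tt
True-or-not false = inj₂ tt

-- Side k has extra k p + 1 colours at place p; surplus copies get colour 0, and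
-- pendant vertices behave like inner vertices of colour 0. A true value directs
-- the arc from side 0 to side 1 (crosses), from an inner vertex to the centre (up),
-- or from a far vertex to the inner one (top); the two ends' colours are passed in
-- that order. With single k the scheme is meant for one inner vertex on side k.
record Scheme : Set where
  field
    extra   : Fin 2 → Place → ℕ
    crosses : ℕ → ℕ → Bool
    up      : Fin 2 → ℕ → ℕ → Bool
    top     : Fin 2 → ℕ → ℕ → Bool
    single  : Fin 2 → Bool

  width : Fin 2 → Place → ℕ
  width k pend = 1
  width k p    = suc (extra k p)

Type : Set
Type = Place × Fin 2 × ℕ

role : Place → Place
role centre = centre
role inner  = inner
role pend   = inner
role far    = far

_≟ₚ_ : (p q : Place) → Dec (p ≡ q)
centre ≟ₚ centre = yes refl
centre ≟ₚ inner  = no λ ()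
centre ≟ₚ pend   = no λ ()
centre ≟ₚ far    = no λ ()
inner  ≟ₚ centre = no λ ()
inner  ≟ₚ inner  = yes refl
inner  ≟ₚ pend   = no λ ()
inner  ≟ₚ far    = no λ ()
pend   ≟ₚ centre = no λ ()
pend   ≟ₚ inner  = no λ ()
pend   ≟ₚ pend   = yes refl
pend   ≟ₚ far    = no λ ()
far    ≟ₚ centre = no λ ()
far    ≟ₚ inner  = no λ ()
far    ≟ₚ pend   = no λ ()
far    ≟ₚ far    = yes refl

_≟ᵀ_ : (s t : Type) → Dec (s ≡ t)
_≟ᵀ_ = Prodₚ.≡-dec _≟ₚ_ (Prodₚ.≡-dec Fin._≟_ ℕ._≟_)

module _ (S : Scheme) where
  open Scheme S

  -- Only the direction is recorded. That the sides agree and the vertices are adjacent is tested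
  -- separately, by `linked` in the template and by `Adj` in the multiplication.
  between : Place → Place → Fin 2 × ℕ → Fin 2 × ℕ → Bool
  between centre centre (0F , a) (1F , b) = crosses a b
  between centre centre (1F , b) (0F , a) = not (crosses a b)
  between inner  centre (k , p)  (_ , a)  = up k p a
  between centre inner  (_ , a)  (k , p)  = not (up k p a)
  between far    inner  (k , x)  (_ , p)  = top k x p
  between inner  far    (_ , p)  (k , x)  = not (top k x p)
  between _      _      _        _        = false

  arc : Type → Type → Bool
  arc (p , s) (q , t) = between p q s t

  between-asym : ∀ p q s t → True (between p q s t) → True (between q p t s) → ⊥
  between-asym centre centre (0F , a) (1F , b)     = True-not (crosses a b)
  between-asym centre centre (1F , b) (0F , a) e f = True-not (crosses a b) f e
  between-asym inner  centre (k , p)  (_ , a)      = True-not (up k p a)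
  between-asym centre inner  (_ , a)  (k , p)  e f = True-not (up k p a) f e
  between-asym far    inner  (k , x)  (_ , p)      = True-not (top k x p)
  between-asym inner  far    (_ , p)  (k , x)  e f = True-not (top k x p) f e

  arc-asym : ∀ s t → True (arc s t) → True (arc t s) → ⊥
  arc-asym (p , s) (q , t) = between-asym p q s t

  -- The template has two copies (groups) of a broom with one branch on each side,
  -- one for each end of the walk sought; an inner and a far node are adjacent only
  -- within a group, unless side k is single.
  Node : Set
  Node = Σ (Fin 2 × Fin 2 × Place) λ (_ , k , p) → Fin (width k p)

  type : Node → Type
  type ((_ , k , p) , a) = role p , k , toℕ a

  _==_ : Fin 2 → Fin 2 → Bool
  k == l = does (k Fin.≟ l)

  linked : Fin 2 × Fin 2 × Place → Fin 2 × Fin 2 × Place → Bool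
  linked (_ , k , centre) (_ , l , centre) = l == opposite k
  linked (_ , k , centre) (_ , l , inner)  = k == l
  linked (_ , k , centre) (_ , l , pend)   = k == l
  linked (_ , k , inner)  (_ , l , centre) = k == l
  linked (_ , k , pend)   (_ , l , centre) = k == l
  linked (g , k , inner)  (h , l , far)    = k == l ∧ (single k ∨ g == h)
  linked (g , k , far)    (h , l , inner)  = k == l ∧ (single k ∨ h == g)
  linked _ _                               = false

  templateArc : Node → Node → Bool
  templateArc n m = linked (proj₁ n) (proj₁ m) ∧ arc (type n) (type m)

  places : List Place
  places = centre ∷ inner ∷ pend ∷ far ∷ []

  place∈ : ∀ p → p List.∈ places
  place∈ centre = here refl
  place∈ inner  = there (here refl)
  place∈ pend   = there (there (here refl))
  place∈ far    = there (there (there (here refl)))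

  nodesAt : Fin 2 → Fin 2 → Place → List Node
  nodesAt g k p = map (λ a → (g , k , p) , a) (allFin (width k p))

  nodesOn : Fin 2 → Fin 2 → List Node
  nodesOn g k = concatMap (nodesAt g k) places

  group : Fin 2 → List Node
  group g = concatMap (nodesOn g) (allFin 2)

  node∈ : ∀ g k p a → ((g , k , p) , a) List.∈ group g
  node∈ g k p a = Listₚ.∈-concatMap⁺ (nodesOn g) (List.lose (Listₚ.∈-allFin k)
    (Listₚ.∈-concatMap⁺ (nodesAt g k) (List.lose (place∈ p)
      (Listₚ.∈-map⁺ (λ a → (g , k , p) , a) (Listₚ.∈-allFin a)))))

  Rapid : Set
  Rapid = ∀ k p a l q b → ∃ λ j → j ≤ 5 ×
    Walk (λ ν μ → True (templateArc ν μ)) j ((0F , k , p) , a) ((1F , l , q) , b)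

  -- For a concrete scheme the premise reduces to the unit type, so that type checking performs the
  -- search.
  check : True (joined-within-5 templateArc (group 0F ++ group 1F) (group 0F) (group 1F)) → Rapid
  check ok k p a l q b = joined-sound templateArc (group 0F ++ group 1F) ok
    {(0F , k , p) , a} {(1F , l , q) , b} (node∈ 0F k p a) (node∈ 1F l q b)

-- With inner out-neighbourhoods {0,1} and {0} over three copies of c 0, every far
-- copy on side 0 sends its walks into {0,1} and receives them from {1,2}.
threeCentres : Scheme
threeCentres = record
  { extra = extra ; crosses = _≡ᵇ_ ; up = up ; top = λ _ _ p → p ≡ᵇ 0 ; single = λ _ → false }
  where
  extra : Fin 2 → Place → ℕ
  extra 0F centre = 2
  extra 1F centre = 1
  extra _  inner  = 1
  extra _  _      = 0
  up : Fin 2 → ℕ → ℕ → Bool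
  up 0F 0 a = not (a ≡ᵇ 2)
  up 0F _ a = a ≡ᵇ 0
  up 1F p a = p ≡ᵇ a

-- Four copies of an inner vertex let every far copy both reach and be reached from
-- each copy of the centre in two steps.
wide : Scheme
wide = record
  { extra = extra ; crosses = _≡ᵇ_ ; up = λ _ → up ; top = λ _ → top ; single = λ _ → false }
  where
  extra : Fin 2 → Place → ℕ
  extra _ inner = 3
  extra _ _     = 1
  up : ℕ → ℕ → Bool
  up p a = p % 2 ≡ᵇ a
  top : ℕ → ℕ → Bool
  top x p = p / 2 ≡ᵇ x

-- All far copies on side 0 share the copies of one inner vertex, and its two colours join them
-- within four steps without the centre. Walks to side 1 leave through colour 0 of `c 0F`; walks
-- from side 1 enter through colour 1.
narrow : Scheme
narrow = record
  { extra = extra ; crosses = λ a _ → a ≡ᵇ 0 ; up = up ; top = top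
  ; single = λ k → does (k Fin.≟ 0F) }
  where
  extra : Fin 2 → Place → ℕ
  extra 1F far = 0
  extra _  _   = 1
  up : Fin 2 → ℕ → ℕ → Bool
  up 0F _ a = a ≡ᵇ 0
  up 1F p a = p ≡ᵇ a
  top : Fin 2 → ℕ → ℕ → Bool
  top 0F x p = x ≡ᵇ p
  top 1F _ p = p ≡ᵇ 0

threeCentres-rapid : Rapid threeCentres
threeCentres-rapid = check threeCentres tt

wide-rapid : Rapid wide
wide-rapid = check wide tt

narrow-rapid : Rapid narrow
narrow-rapid = check narrow tt

cap : ℕ → ℕ → ℕ
cap w a with a <? w
... | yes _ = a
... | no  _ = 0

cap< : ∀ w a → cap (suc w) a < suc w
cap< w a with a <? suc w
... | yes a<w = a<w
... | no  _   = s≤s z≤n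

cap-id : ∀ {w a} → a < w → cap w a ≡ a
cap-id {w} {a} a<w with a <? w
... | yes _  = refl
... | no a≮w = ⊥-elim (a≮w a<w)

-- Locating the vertices of the tree around its centres.

module Broom {n} (T : Graph (Fin n)) (acyclic : Acyclic T)
  (trail : ∀ x y → ∃ λ k → Trails.Trail Fin._≟_ T acyclic k x x y)
  (c : Fin 2 → Fin n) (bridged : ∀ k → Adj T (c k) (c (opposite k)))
  (short : ∀ k {d p y} → Trails.Trail Fin._≟_ T acyclic d p (c k) y → d ≤ 3) where

  open Trails Fin._≟_ T acyclic

  data Located (k : Fin 2) : Place → Fin n → Set where
    centre : Located k centre (c k)
    inner  : ∀ {i w} → Adj T (c k) i → i ≢ c (opposite k) → Adj T i w → w ≢ c k →
             Located k inner i
    pend   : ∀ {i} → Adj T (c k) i → i ≢ c (opposite k) → (∀ w → Adj T i w → w ≡ c k) →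
             Located k pend i
    far    : ∀ {u i} → Adj T (c k) u → u ≢ c (opposite k) → Adj T u i → i ≢ c k →
             Located k far i

  data Link : Fin 2 → Place → Fin 2 → Place → Set where
    bridge     : ∀ k → Link k centre (opposite k) centre
    innerStem  : ∀ k → Link k inner k centre
    innerStem⁻ : ∀ k → Link k centre k inner
    pendStem   : ∀ k → Link k pend k centre
    pendStem⁻  : ∀ k → Link k centre k pend
    twig       : ∀ k → Link k far k inner
    twig⁻      : ∀ k → Link k inner k far

  private
    c≢ : ∀ k → c k ≢ c (opposite k)
    c≢ k = adj⇒≢ (bridged k)

  locate-near : ∀ k {i} → Adj T (c k) i → i ≢ c (opposite k) → ∃ λ p → Located k p i
  locate-near k {i} e i≢ with Finₚ.any? (λ w → adj? T i w ×-dec ¬? (w Fin.≟ c k))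
  ... | yes (w , f , w≢) = inner , inner e i≢ f w≢
  ... | no none          = pend , pend e i≢ only
    where
    only : ∀ w → Adj T i w → w ≡ c k
    only w f with w Fin.≟ c k
    ... | yes w≡ = w≡
    ... | no w≢  = ⊥-elim (none (w , f , w≢))

  locate-within-2 : ∀ k {d i} → Trail d (c (opposite k)) (c k) i → d ≤ 2 → ∃ λ p → Located k p i
  locate-within-2 k []                         _ = centre , centre
  locate-within-2 k (step e u≢ [])             _ = locate-near k e u≢
  locate-within-2 k (step e u≢ (step f i≢ [])) _ = far , far e u≢ f i≢
  locate-within-2 k (step _ _ (step _ _ (step _ _ _))) (s≤s (s≤s ()))

  locate : ∀ i → ∃₂ λ k p → Located k p i
  locate i with trail (c 0F) i
  ... | _ , [] = 0F , centre , centre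
  ... | _ , step {z = z} e z≢ t with z Fin.≟ c 1F
  ...   | yes refl = 1F , locate-within-2 1F t
                            (ℕₚ.+-cancelˡ-≤ 1 _ _ (short 0F (step {p = c 0F} e z≢ t)))
  -- Begun at `c 1F` with the bridge, the trail still has at most 3 edges, which leaves 2 for the
  -- part from `c 0F`.
  ...   | no z≢c₁  = 0F , locate-within-2 0F (step e z≢c₁ t) (ℕₚ.+-cancelˡ-≤ 1 _ _
                            (short 1F (step (bridged 1F) (c≢ 0F) (step e z≢c₁ t))))

  fromCentre : ∀ {k p i} → Located k p i → Trail (depth p) (c (opposite k)) (c k) i
  fromCentre centre           = []
  fromCentre (inner e i≢ _ _) = step e i≢ []
  fromCentre (pend e i≢ _)    = step e i≢ []
  fromCentre (far e u≢ f i≢)  = step e u≢ (step f i≢ [])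

  acrossBridge : ∀ {k p i} → Located k p i →
    Trail (suc (depth p)) (c (opposite k)) (c (opposite k)) i
  acrossBridge {k} x = step (sym T (bridged k)) (c≢ k) (fromCentre x)

  place-unique : ∀ {k p q i} → Located k p i → Located k q i → p ≡ q
  place-unique x y = go x y (length-unique (fromCentre x) (fromCentre y))
    where
    go : ∀ {k p q i} → Located k p i → Located k q i → depth p ≡ depth q → p ≡ q
    go centre            centre            _ = refl
    go (inner _ _ _ _)   (inner _ _ _ _)   _ = refl
    go (inner _ _ f w≢)  (pend _ _ only)   _ = ⊥-elim (w≢ (only _ f))
    go (pend _ _ only)   (inner _ _ f w≢)  _ = ⊥-elim (w≢ (only _ f))
    go (pend _ _ _)      (pend _ _ _)      _ = refl
    go (far _ _ _ _)     (far _ _ _ _)     _ = refl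

  -- Crossing the bridge adds one to the depth, so a vertex on both sides would have two depths,
  -- each exceeding the other by one.
  located-unique : ∀ {k l p q i} → Located k p i → Located l q i → (k , p) ≡ (l , q)
  located-unique {k} {l} x y with k Fin.≟ l
  ... | yes refl = cong (k ,_) (place-unique x y)
  ... | no k≢l with ≢⇒opposite k≢l | ≢⇒opposite (≢-sym k≢l)
  ...   | refl | k≡ = ⊥-elim (ℕₚ.<-irrefl (≡.trans (≡.sym q+1≡p) (cong suc (≡.sym p+1≡q)))
                                (ℕₚ.m≤n⇒m≤1+n (ℕₚ.n<1+n _)))
    where
    p+1≡q = length-unique (acrossBridge x) (fromCentre y)
    q+1≡p = length-unique (subst (λ j → Trail _ (c j) (c j) _) (≡.sym k≡) (acrossBridge y))
              (fromCentre x)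

  neighbour : ∀ {k p i j} → Located k p i → Adj T i j →
    ∃₂ λ l q → Located l q j × Link k p l q
  neighbour {k} {j = j} centre e with j Fin.≟ c (opposite k)
  ... | yes refl = opposite k , centre , centre , bridge k
  ... | no j≢ with locate-near k e j≢
  ...   | inner , x            = k , inner , x , innerStem⁻ k
  ...   | pend  , x            = k , pend , x , pendStem⁻ k
  ...   | centre , centre      = ⊥-elim (irrefl T refl e)
  ...   | far , far g u≢ f i≢  = ⊥-elim (ℕₚ.1+n≢n (≡.sym
                                   (length-unique (step {p = c k} e (≢-sym (adj⇒≢ e)) [])
                                     (fromCentre (far g u≢ f i≢)))))
  neighbour {k} {j = j} (inner e i≢ f w≢) g with j Fin.≟ c k
  ... | yes refl = k , centre , centre , innerStem k
  ... | no j≢    = k , far , far e i≢ g j≢ , twig⁻ k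
  neighbour {k} (pend e i≢ only) g with only _ g
  ... | refl = k , centre , centre , pendStem k
  neighbour {k} {i = i} {j} (far {u = u} e u≢ f i≢) g with j Fin.≟ u
  ... | yes refl = k , inner , inner e u≢ f i≢ , twig k
  -- Such a `j` would end a trail of length 4 from the opposite centre.
  ... | no j≢    = ⊥-elim (ℕₚ.<⇒≱ ℕₚ.≤-refl (short (opposite k)
                     (step (sym T (bridged k)) (c≢ k) (step e u≢ (step f i≢ (step g j≢ []))))))

  -- Orientations from colour schemes.

  module Colouring (S : Scheme) (s : Fin n → ℕ)
    (fits : ∀ {k p i} → Located k p i → Scheme.width S k p ≤ s i)
    (inhabited : ∀ k → ∃ (Located k inner))
    (alone : ∀ k → True (Scheme.single S k) →
       ∀ {u v} → Located k inner u → Located k inner v → u ≡ v)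
    (rapid : Rapid S) where

    open Scheme S

    V : Set
    V = Σ (Fin n) λ i → Fin (s i)

    1≤width : ∀ k p → 1 ≤ width k p
    1≤width k centre = s≤s z≤n
    1≤width k inner  = s≤s z≤n
    1≤width k pend   = s≤s z≤n
    1≤width k far    = s≤s z≤n

    cap<width : ∀ k p a → cap (width k p) a < width k p
    cap<width k centre = cap< _
    cap<width k inner  = cap< _
    cap<width k pend   = cap< _
    cap<width k far    = cap< _

    typeOf : V → Type
    typeOf (i , j) with locate i
    ... | k , p , _ = role p , k , cap (width k p) (toℕ j)

    typeOf-located : ∀ {k p i} → Located k p i → (j : Fin (s i)) →
      typeOf (i , j) ≡ (role p , k , cap (width k p) (toℕ j))
    typeOf-located {i = i} x j with locate i
    ... | l , q , y with located-unique y x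
    ...   | refl = refl

    link-total : ∀ {k p l q} → Link k p l q → ∀ a b →
      True (arc S (role p , k , a) (role q , l , b)) ⊎
      True (arc S (role q , l , b) (role p , k , a))
    link-total (bridge 0F)     a b = True-or-not (crosses a b)
    link-total (bridge 1F)     a b = Sum.swap (True-or-not (crosses b a))
    link-total (innerStem k)   a b = True-or-not (up k a b)
    link-total (innerStem⁻ k)  a b = Sum.swap (True-or-not (up k b a))
    link-total (pendStem k)    a b = True-or-not (up k a b)
    link-total (pendStem⁻ k)   a b = Sum.swap (True-or-not (up k b a))
    link-total (twig k)        a b = True-or-not (top k a b)
    link-total (twig⁻ k)       a b = Sum.swap (True-or-not (top k b a))

    orientation : Orientation (T ⟨ s ⟩)
    orientation = record
      { Arc     = λ x y → Adj (T ⟨ s ⟩) x y × True (arc S (typeOf x) (typeOf y))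
      ; arc⇒adj = proj₁
      ; adj⇒arc = λ {x} {y} → total (proj₂ (proj₂ (locate (proj₁ x)))) x y refl
      ; asym    = λ {x} {y} (_ , e) (_ , f) → arc-asym S (typeOf x) (typeOf y) e f
      }
      where
      total : ∀ {k p i} → Located k p i → ∀ x y → proj₁ x ≡ i → Adj (T ⟨ s ⟩) x y →
        (Adj (T ⟨ s ⟩) x y × True (arc S (typeOf x) (typeOf y))) ⊎
        (Adj (T ⟨ s ⟩) y x × True (arc S (typeOf y) (typeOf x)))
      total x (i , a) (j , b) refl e with neighbour x (proj₂ e)
      ... | l , q , y , link = Sum.map
              (λ t → e , ≡.subst₂ (λ s t → True (arc S s t)) (≡.sym tx) (≡.sym ty) t)
              (λ t → sym (T ⟨ s ⟩) {i , a} {j , b} e ,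
                     ≡.subst₂ (λ s t → True (arc S s t)) (≡.sym ty) (≡.sym tx) t)
              (link-total link _ _)
        where
        tx = typeOf-located x a
        ty = typeOf-located y b

    -- lobe serves the pendant nodes of the template; on a side without pendant
    -- vertices the inner vertex itself can stand in.
    record Branch (k : Fin 2) : Set where
      field
        hub tip lobe : Fin n
        hubLocated  : Located k inner hub
        hub-tip     : Adj T hub tip
        tip≢        : tip ≢ c k
        lobePlace   : Place
        lobeLocated : Located k lobePlace lobe
        lobeRole    : role lobePlace ≡ inner

      spot : Place → Fin n
      spot centre = c k
      spot inner  = hub
      spot pend   = lobe
      spot far    = tip

    open Branch

    fromInner : ∀ {k u} → Located k inner u → Branch k
    fromInner x@(inner {w = w} e u≢ f w≢) = record
      { hub = _ ; tip = w ; lobe = _ ; hubLocated = x ; hub-tip = f ; tip≢ = w≢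
      ; lobePlace = inner ; lobeLocated = x ; lobeRole = refl }

    branch : ∀ k → Branch k
    branch k = fromInner (proj₂ (inhabited k))

    branchAt : ∀ {k p i} → Located k p i → Σ (Branch k) λ b → spot b p ≡ i
    branchAt {k} centre         = branch k , refl
    branchAt x@(inner _ _ _ _)  = fromInner x , refl
    branchAt {k} x@(pend _ _ _) =
      record (branch k)
        { lobe = _ ; lobePlace = pend ; lobeLocated = x ; lobeRole = refl } , refl
    branchAt (far e u≢ f i≢)    = fromInner (inner e u≢ f i≢) , refl

    withBranch : ∀ {k} (b : Branch k) → Σ (∀ l → Branch l) λ bs → bs k ≡ b
    withBranch {0F} b = (λ where 0F → b ; 1F → branch 1F) , refl
    withBranch {1F} b = (λ where 0F → branch 0F ; 1F → b) , refl

    through : ∀ {k p i} → Located k p i → Σ (∀ l → Branch l) λ bs → spot (bs k) p ≡ i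
    through x with branchAt x
    ... | b , eq with withBranch b
    ...   | bs , refl = bs , eq

    spot-located : ∀ {k} (b : Branch k) p →
      ∃ λ q → Located k q (spot b p) × role q ≡ role p × width k p ≤ width k q
    spot-located b centre = centre , centre , refl , ℕₚ.≤-refl
    spot-located b inner  = inner , hubLocated b , refl , ℕₚ.≤-refl
    spot-located b pend   = lobePlace b , lobeLocated b , lobeRole b , 1≤width _ (lobePlace b)
    spot-located b far with hubLocated b
    ... | inner e u≢ _ _ = far , far e u≢ (hub-tip b) (tip≢ b) , refl , ℕₚ.≤-refl

    Copy : Fin n → Type → Set
    Copy i t = Σ (Fin (s i)) λ j → typeOf (i , j) ≡ t

    -- The colour itself serves as the index of the copy: `fits` leaves room for it, and `cap` fixes
    -- numbers below the width.
    copy : ∀ {k} (b : Branch k) p (a : Fin (width k p)) → Copy (spot b p) (role p , k , toℕ a)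
    copy {k} b p a with spot-located b p
    ... | q , x , same , w≤ = fromℕ< a<s , ≡.trans (typeOf-located x _)
            (cong₂ (λ r a → r , k , a) same
              (≡.trans (cong (cap (width k q)) (Finₚ.toℕ-fromℕ< a<s)) (cap-id a<w)))
      where
      a<w : toℕ a < width k q
      a<w = ℕₚ.≤-trans (Finₚ.toℕ<n a) w≤
      a<s : toℕ a < s (spot b p)
      a<s = ℕₚ.≤-trans a<w (fits x)

    -- Several copies may share a colour, but the walk sought has prescribed ends. Such an end
    -- displaces the default copy wherever vertex and type match.
    preferring : V → ∀ {i t} → Copy i t → Copy i t
    preferring v {i} {t} d with proj₁ v Fin.≟ i
    ... | no _ = d
    ... | yes refl with typeOf v ≟ᵀ t
    ...   | no _  = d
    ...   | yes e = proj₂ v , e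

    preferring-hit : ∀ v {i t} (d : Copy i t) → i ≡ proj₁ v → t ≡ typeOf v →
      (i , proj₁ (preferring v d)) ≡ v
    preferring-hit v d refl refl with proj₁ v Fin.≟ proj₁ v
    ... | no ≢ = ⊥-elim (≢ refl)
    ... | yes refl with typeOf v ≟ᵀ typeOf v
    ...   | no ≢ = ⊥-elim (≢ refl)
    ...   | yes _ = refl

    colour : V → ∀ k p → Fin (width k p)
    colour (_ , j) k p = fromℕ< (cap<width k p (toℕ j))

    -- The two groups may overlap in the tree: a homomorphism, injective or not, carries walks over.
    module Embed (branches : Fin 2 → ∀ k → Branch k) (ends : Fin 2 → V) where

      at : Fin 2 × Fin 2 × Place → Fin n
      at (g , k , p) = spot (branches g k) p

      chosen : (ν : Node S) → Copy (at (proj₁ ν)) (type S ν)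
      chosen ((g , k , p) , a) = preferring (ends g) (copy (branches g k) p a)

      embed : Node S → V
      embed ν = at (proj₁ ν) , proj₁ (chosen ν)

      hit : ∀ g v {k p} → Located k p (proj₁ v) → at (g , k , p) ≡ proj₁ v → ends g ≡ v →
        embed ((g , k , p) , colour v k p) ≡ v
      hit g v x at≡ refl = preferring-hit v _ at≡
        (≡.trans (cong (λ a → _ , _ , a) (Finₚ.toℕ-fromℕ< _)) (≡.sym (typeOf-located x (proj₂ v))))

      same : ∀ {k l : Fin 2} → True (does (k Fin.≟ l)) → k ≡ l
      same {k} {l} e with k Fin.≟ l
      ... | yes k≡l = k≡l

      stem : ∀ {k p i} → role p ≡ inner → Located k p i → Adj T (c k) i
      stem _ (inner e _ _ _) = e
      stem _ (pend e _ _)    = e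

      -- Across groups the hub and the tip come from different branches; on a single side `alone`
      -- identifies the two hubs.
      twigs : ∀ g h k → True (single k ∨ does (g Fin.≟ h)) →
        Adj T (hub (branches g k)) (tip (branches h k))
      twigs g h k ok with Equivalence.to (Boolₚ.T-∨ {single k}) ok
      ... | inj₁ one = subst (λ u → Adj T u (tip (branches h k)))
                         (alone k one (hubLocated (branches h k)) (hubLocated (branches g k)))
                         (hub-tip (branches h k))
      ... | inj₂ g≡h with same {g} {h} g≡h
      ...   | refl = hub-tip (branches g k)

      linked-adj : ∀ x y → True (linked S x y) → Adj T (at x) (at y)
      linked-adj (_ , k , centre) (_ , l , centre) e with same {l} {opposite k} e
      ... | refl = bridged k
      linked-adj (_ , k , centre) (h , l , inner)  e with same {k} {l} e
      ... | refl = stem refl (hubLocated (branches h k))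
      linked-adj (_ , k , centre) (h , l , pend)   e with same {k} {l} e
      ... | refl = stem (lobeRole (branches h k)) (lobeLocated (branches h k))
      linked-adj (g , k , inner)  (_ , l , centre) e with same {k} {l} e
      ... | refl = sym T (stem refl (hubLocated (branches g k)))
      linked-adj (g , k , pend)   (_ , l , centre) e with same {k} {l} e
      ... | refl = sym T (stem (lobeRole (branches g k)) (lobeLocated (branches g k)))
      linked-adj (g , k , inner)  (h , l , far)    e
        with Equivalence.to (Boolₚ.T-∧ {does (k Fin.≟ l)}) e
      ... | k≡l , ok with same {k} {l} k≡l
      ...   | refl = twigs g h k ok
      linked-adj (g , k , far)    (h , l , inner)  e
        with Equivalence.to (Boolₚ.T-∧ {does (k Fin.≟ l)}) e
      ... | k≡l , ok with same {k} {l} k≡l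
      ...   | refl = sym T (twigs h g k ok)

      embed-arc : ∀ ν μ → True (templateArc S ν μ) → Arc orientation (embed ν) (embed μ)
      embed-arc ν μ e = ((λ eq → irrefl T eq adj) , adj) ,
        ≡.subst₂ (λ t u → True (arc S t u)) (≡.sym (proj₂ (chosen ν))) (≡.sym (proj₂ (chosen μ)))
          (proj₂ both)
        where
        both : True (linked S (proj₁ ν) (proj₁ μ)) × True (arc S (type S ν) (type S μ))
        both = Equivalence.to Boolₚ.T-∧ e
        adj : Adj T (at (proj₁ ν)) (at (proj₁ μ))
        adj = linked-adj (proj₁ ν) (proj₁ μ) (proj₁ both)

      embed-walk : ∀ {k ν μ} → Walk (λ ν μ → True (templateArc S ν μ)) k ν μ →
        Walk (Arc orientation) k (embed ν) (embed μ)
      embed-walk []      = []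
      embed-walk (e ∷ w) = embed-arc _ _ e ∷ embed-walk w

    joined : ∀ x y {k p l q} → Located k p (proj₁ x) → Located l q (proj₁ y) →
      ∃ λ j → j ≤ 5 × Walk (Arc orientation) j x y
    joined x y {k} {p} {l} {q} at-x at-y with through at-x | through at-y
    ... | bs , b-x | bs′ , b′-y with rapid k p (colour x k p) l q (colour y l q)
    ...   | j , j≤5 , w = j , j≤5 ,
      ≡.subst₂ (Walk _ j) (hit 0F x at-x b-x refl) (hit 1F y at-y b′-y refl) (embed-walk w)
      where
      branches : Fin 2 → ∀ k → Branch k
      branches 0F = bs
      branches 1F = bs′
      ends : Fin 2 → V
      ends 0F = x
      ends 1F = y
      open Embed branches ends

    oriented : Σ (Orientation (T ⟨ s ⟩)) λ D → Within5 (Arc D)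
    oriented = orientation , λ x y →
      joined x y (proj₂ (proj₂ (locate (proj₁ x)))) (proj₂ (proj₂ (locate (proj₁ y))))

-- The obstruction to diameter 5.

reverse : ∀ {V : Set} {R : Rel V 0ℓ} {k x y} → Walk R k x y → Walk (λ u v → R v u) k y x
reverse []      = []
reverse (e ∷ w) = snoc (reverse w) e

pigeonhole₂ : ∀ {m} → m ≡ 2 → {x y z : Fin m} → x ≢ y → z ≢ x → z ≡ y
pigeonhole₂ refl {0F} {0F}      x≢y z≢x = ⊥-elim (x≢y refl)
pigeonhole₂ refl {0F} {1F} {0F} x≢y z≢x = ⊥-elim (z≢x refl)
pigeonhole₂ refl {0F} {1F} {1F} x≢y z≢x = refl
pigeonhole₂ refl {1F} {0F} {0F} x≢y z≢x = refl
pigeonhole₂ refl {1F} {0F} {1F} x≢y z≢x = ⊥-elim (z≢x refl)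
pigeonhole₂ refl {1F} {1F}      x≢y z≢x = ⊥-elim (x≢y refl)

-- The bound 3 on the multiplicity enters here: among the copies of its hub, a copy of a tip has at
-- most one out-neighbour or at most one in-neighbour.
one-sided : ∀ {m} → 1 ≤ m → m ≤ 3 → {P : Fin m → Set} → (∀ i → Dec (P i)) →
  (∃ λ i → ∀ j → P j → j ≡ i) ⊎ (∃ λ i → ∀ j → ¬ P j → j ≡ i)
one-sided {1} _ _ P? = inj₁ (0F , λ where 0F _ → refl)
one-sided {2} _ _ P? with P? 0F
... | yes p = inj₂ (1F , λ where 0F ¬p → ⊥-elim (¬p p) ; 1F _ → refl)
... | no ¬p = inj₁ (1F , λ where 0F p → ⊥-elim (¬p p) ; 1F _ → refl)
one-sided {3} _ _ P? with P? 0F | P? 1F | P? 2F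
... | yes p | yes q | _     =
  inj₂ (2F , λ where 0F ¬p → ⊥-elim (¬p p) ; 1F ¬q → ⊥-elim (¬q q) ; 2F _ → refl)
... | no ¬p | no ¬q | _     =
  inj₁ (2F , λ where 0F p → ⊥-elim (¬p p) ; 1F q → ⊥-elim (¬q q) ; 2F _ → refl)
... | yes p | no _  | yes r =
  inj₂ (1F , λ where 0F ¬p → ⊥-elim (¬p p) ; 1F _ → refl ; 2F ¬r → ⊥-elim (¬r r))
... | yes _ | no ¬q | no ¬r =
  inj₁ (0F , λ where 0F _ → refl ; 1F q → ⊥-elim (¬q q) ; 2F r → ⊥-elim (¬r r))
... | no _  | yes q | yes r =
  inj₂ (0F , λ where 0F _ → refl ; 1F ¬q → ⊥-elim (¬q q) ; 2F ¬r → ⊥-elim (¬r r))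
... | no ¬p | yes _ | no ¬r =
  inj₁ (1F , λ where 0F p → ⊥-elim (¬p p) ; 1F _ → refl ; 2F r → ⊥-elim (¬r r))
one-sided {suc (suc (suc (suc _)))} _ (s≤s (s≤s (s≤s ())))

arc? : ∀ {V} {G : Graph V} (D : Orientation G) → Decidable (Arc D)
arc? {G = G} D x y with adj? G x y
... | no ¬e = no λ e → ¬e (arc⇒adj D e)
... | yes e with adj⇒arc D e
...   | inj₁ f = yes f
...   | inj₂ f = no λ g → asym D f g

record Arm {n} (G : Graph (Fin n)) (a b : Fin n) : Set where
  field
    {hub tip} : Fin n
    stem      : Adj G a hub
    hub≢      : hub ≢ b
    twig      : Adj G hub tip
    tip≢      : tip ≢ a

open Arm

module Geodesics {n} (G : Graph (Fin n)) (acyclic : Acyclic G) (s : Fin n → ℕ)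
  (R : Rel (Σ (Fin n) λ i → Fin (s i)) 0ℓ)
  (R⇒adj : ∀ {x y} → R x y → Adj G (proj₁ x) (proj₁ y)) where

  open Trails Fin._≟_ G acyclic

  -- Recursion on the trail makes this compute to nested pairs, so that matching can name the copies
  -- visited.
  Along : ∀ {d p i j} → Trail d p i j → Fin (s i) → Fin (s j) → Set
  Along {i = i} {j} [] a b                   = a ≡ b
  Along {i = i} {j} (step {z = z} _ _ t) a b = ∃ λ c → R (i , a) (z , c) × Along t c b

  project : ∀ {k x y} → Walk R k x y → Walk (Adj G) k (proj₁ x) (proj₁ y)
  project []      = []
  project (e ∷ w) = R⇒adj e ∷ project w

  -- A walk one longer than the geodesic is impossible: a first step off the trail
  -- makes the remaining distance longer by two than a step along it.
  follow : ∀ {d k p i j a b} (t : Trail d p i j) →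
    Walk R k (i , a) (j , b) → k ≤ suc d → Along t a b
  follow []            []             _          = refl
  follow []            (e ∷ [])       _          = ⊥-elim (irrefl G refl (R⇒adj e))
  follow []            (_ ∷ (_ ∷ _))  (s≤s ())
  follow t@(step _ _ _) []            _          = ⊥-elim (no-closed t)
  follow (step {z = z} e ne t) (_∷_ {y = z′ , _} f w) (s≤s k≤) with z′ Fin.≟ z
  ... | yes refl = _ , f , follow t w k≤
  ... | no z′≢z  = ⊥-elim (ℕₚ.<⇒≱ (s≤s k≤) (trail≤walk
                     (step (sym G (R⇒adj f)) (adj⇒≢ (R⇒adj f)) (step e (≢-sym z′≢z) t))
                     (project w)))

  module _ {a b : Fin n} (ab : Adj G a b) where

    fork : (x y : Arm G a b) → hub x ≢ hub y → Trail 4 (tip x) (tip x) (tip y)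
    fork x y x≢y = step (sym G (twig x)) (adj⇒≢ (twig x)) (step (sym G (stem x)) (≢-sym (tip≢ x))
      (step (stem y) (≢-sym x≢y) (step (twig y) (tip≢ y) [])))

    cross : (x : Arm G a b) (y : Arm G b a) → Trail 4 (tip x) (tip x) (hub y)
    cross x y = step (sym G (twig x)) (adj⇒≢ (twig x)) (step (sym G (stem x)) (≢-sym (tip≢ x))
      (step ab (≢-sym (hub≢ x)) (step (stem y) (hub≢ y) [])))

    cross⁻ : (x : Arm G a b) (y : Arm G b a) → Trail 4 (hub x) (hub x) (tip y)
    cross⁻ x y = step (sym G (stem x)) (adj⇒≢ (stem x)) (step ab (≢-sym (hub≢ x))
      (step (stem y) (hub≢ y) (step (twig y) (tip≢ y) [])))

  module _ (asym : ∀ {x y} → R x y → ¬ R y x) (close : Within5 R) where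

    -- A detour costs two steps, so within 5 steps a walk between vertices at distance 4 makes none.
    along : ∀ {p i j} (t : Trail 4 p i j) → ∀ a b → Along t a b
    along {i = i} {j} t a b with close (i , a) (j , b)
    ... | k , k≤5 , w = follow t w k≤5

    in≢out : ∀ {i u v z} → R (i , u) z → R z (i , v) → u ≢ v
    in≢out e f refl = asym e f

    -- The copies of a are β → p → α, and the arms X′ and Y force a copy b₀ of b with
    -- b₀ → α. From x the copies q₀ and q′ of hub Y and hub Y′ are reached only through
    -- α and the other copy d of b, so that the walk from tip Y to tip Y′ through q₀
    -- and q′ uses b₀. Then both copies of b point to q′, which cannot reach x.
    no-lonely-arc : ∀ {a b} → Adj G a b → s a ≡ 2 → s b ≡ 2 → (∀ i → 1 ≤ s i) →
      (X X′ : Arm G a b) → hub X ≢ hub X′ → (Y Y′ : Arm G b a) → hub Y ≢ hub Y′ →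
      (x : Fin (s (tip X))) (p : Fin (s (hub X))) →
      ¬ (∀ q → R (tip X , x) (hub X , q) → q ≡ p)
    no-lonely-arc {a} {b} ab sa sb 1≤s X X′ X≢ Y Y′ Y≢ x p lonely
      with along (cross (sym G ab) Y X) (fromℕ< (1≤s (tip Y))) p
         | along (fork ab X X′ X≢) x (fromℕ< (1≤s (tip X′)))
    ... | _ , _ , _ , _ , β , _ , _ , βp , refl
        | p₀ , xp , α , pα , p′ , αp′ , _
        with lonely p₀ xp
    ... | refl
        with along (cross (sym G ab) Y X′) (fromℕ< (1≤s (tip Y))) p′
           | along (cross⁻ ab X′ Y) p′ (fromℕ< (1≤s (tip Y)))
           | along (fork (sym G ab) Y Y′ Y≢) (fromℕ< (1≤s (tip Y))) (fromℕ< (1≤s (tip Y′)))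
    ... | _ , _ , b₀ , _ , γ , b₀γ , _ , γp′ , refl
        | ε , p′ε , _
        | q₀ , _ , b₁ , q₀b₁ , q′ , b₁q′ , _
        with along (cross ab X Y) x q₀
           | along (cross ab X Y′) x q′
           | along (cross⁻ (sym G ab) Y′ X) q′ x
    ... | p₁ , xp₁ , α₁ , pα₁ , d , α₁d , _ , dq₀ , refl
        | p₂ , xp₂ , α₂ , pα₂ , d′ , α₂d′ , _ , d′q′ , refl
        | η , q′η , _
        with lonely p₁ xp₁ | lonely p₂ xp₂
    ... | refl | refl
        -- As `α` points to `p′`, the arc from `p′` to `ε` ends in the other copy `β`.
        with pigeonhole₂ sa (≢-sym (in≢out βp pα)) (≢-sym (in≢out αp′ p′ε))
    ... | refl
        -- Now `γ` is `α`, whence the arc from `b₀` to `α`. The walks from `x` also pass `α`, since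
        -- `p` cannot return to `β`.
        with pigeonhole₂ sa (in≢out βp pα) (in≢out γp′ p′ε)
           | pigeonhole₂ sa (in≢out βp pα) (≢-sym (in≢out βp pα₁))
           | pigeonhole₂ sa (in≢out βp pα) (≢-sym (in≢out βp pα₂))
    ... | refl | refl | refl
        -- From `α` both walks must continue to the copy of `b` other than `b₀`; as that copy points
        -- to `q₀`, the way out of `q₀` is `b₁`, equal to `b₀`.
        with pigeonhole₂ sb (in≢out b₀γ α₁d) (≢-sym (in≢out b₀γ α₂d′))
           | pigeonhole₂ sb (in≢out dq₀ q₀b₁) (in≢out b₀γ α₁d)
    -- The copy `η` entered from `q′` is neither `d` nor `b₁`, yet there are only two copies of `b`.
    ... | refl | refl =
        in≢out b₁q′ q′η (≡.sym (pigeonhole₂ sb (in≢out dq₀ q₀b₁) (≢-sym (in≢out d′q′ q′η))))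

-- Finite subsets, and the obstruction for orientations.

module _ {n} {P : Fin n → Set} (P? : ∀ i → Dec (P i)) where

  ∈-tabulate⁺ : ∀ {i} → P i → i ∈ tabulate (λ i → does (P? i))
  ∈-tabulate⁺ {i} p = Vecₚ.lookup⇒[]= i _ (≡.trans (Vecₚ.lookup∘tabulate _ i) (dec-true (P? i) p))

  ∈-tabulate⁻ : ∀ {i} → i ∈ tabulate (λ i → does (P? i)) → P i
  ∈-tabulate⁻ {i} i∈
    with P? i | ≡.trans (≡.sym (Vecₚ.lookup∘tabulate (λ i → does (P? i)) i)) (Vecₚ.[]=⇒lookup i∈)
  ... | yes p | _ = p

∈─⇒∉ : ∀ {n} (p q : Subset n) {x} → x ∈ p ─ q → x ∉ q
∈─⇒∉ (_ ∷ p) (false ∷ q) (there x∈) (there x∈q) = ∈─⇒∉ p q x∈ x∈q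
∈─⇒∉ (_ ∷ p) (true ∷ q)  (there x∈) (there x∈q) = ∈─⇒∉ p q x∈ x∈q

another : ∀ {n} {p : Subset n} {x} → x ∈ p → ∣ p ∣ ≢ 1 → ∃ λ y → y ∈ p × y ≢ x
another {p = p} {x} x∈p ≢1 with Finₚ.any? (λ y → (y Subsetₚ.∈? p) ×-dec ¬? (y Fin.≟ x))
... | yes found = found
... | no none   = ⊥-elim (≢1 (≡.trans (cong ∣_∣ (Subsetₚ.⊆-antisym p⊆ ⊆p)) (Subsetₚ.∣⁅x⁆∣≡1 x)))
  where
  p⊆ : p ⊆ ⁅ x ⁆
  p⊆ {y} y∈ with y Fin.≟ x
  ... | yes refl = Subsetₚ.x∈⁅x⁆ x
  ... | no y≢x   = ⊥-elim (none (y , y∈ , y≢x))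
  ⊆p : ⁅ x ⁆ ⊆ p
  ⊆p y∈ = subst (_∈ p) (≡.sym (Subsetₚ.x∈⁅y⁆⇒x≡y x y∈)) x∈p

singleton-≡ : ∀ {n} {p : Subset n} {x y} → ∣ p ∣ ≡ 1 → x ∈ p → y ∈ p → x ≡ y
singleton-≡ {p = p} {x} {y} one x∈ y∈ with x Fin.≟ y
... | yes x≡y = x≡y
... | no x≢y  = ⊥-elim (ℕₚ.<⇒≢ 1<∣p∣ (≡.sym one))
  where
  y⊆ : ⁅ y ⁆ ⊆ p - x
  y⊆ z∈ with Subsetₚ.x∈⁅y⁆⇒x≡y y z∈
  ... | refl = Subsetₚ.x∈p∧x≢y⇒x∈p-y y∈ (≢-sym x≢y)
  1<∣p∣ : 1 < ∣ p ∣
  1<∣p∣ = ℕₚ.≤-trans (s≤s (subst (_≤ ∣ p - x ∣) (Subsetₚ.∣⁅x⁆∣≡1 y) (Subsetₚ.p⊆q⇒∣p∣≤∣q∣ y⊆)))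
            (Subsetₚ.x∈p⇒∣p-x∣<∣p∣ x∈)

no-rapid-orientation : ∀ {n} (G : Graph (Fin n)) → Acyclic G →
  (s : Fin n → ℕ) → (∀ i → 1 ≤ s i) →
  (D : Orientation (G ⟨ s ⟩)) → Within5 (Arc D) →
  ∀ {a b} → Adj G a b → s a ≡ 2 → s b ≡ 2 →
  (X X′ : Arm G a b) → hub X ≢ hub X′ → (Y Y′ : Arm G b a) → hub Y ≢ hub Y′ → ¬ (s (hub X) ≤ 3)
no-rapid-orientation G acyclic s 1≤s D close ab sa sb X X′ X≢ Y Y′ Y≢ s≤3
  with one-sided (1≤s (hub X)) s≤3 (λ p → arc? D (tip X , fromℕ< (1≤s (tip X))) (hub X , p))
... | inj₁ (p , only) = no-lonely-arc (λ e f → asym D e f) close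
        ab sa sb 1≤s X X′ X≢ Y Y′ Y≢ _ p only
  where
  open Geodesics G acyclic s (Arc D) (λ e → proj₂ (arc⇒adj D e))
-- With at most one in-neighbour, the argument applies to the reversed digraph, in which walks are
-- reversed too.
... | inj₂ (p , only) = no-lonely-arc (λ e f → asym D e f)
        (λ x y → let k , k≤5 , w = close y x in k , k≤5 , reverse w)
        ab sa sb 1≤s X X′ X≢ Y Y′ Y≢ _ p (λ q e → only q (asym D e))
  where
  open Geodesics G acyclic s (λ x y → Arc D y x) (λ e → sym G (proj₂ (arc⇒adj D e)))

-- From orientations to the class of the multiplication.

module Classes {n} (G : Graph (Fin n)) (tree : IsTree G) (diam : IsDiameter (Adj G) 5)
  (c : Fin 2 → Fin n) (c≢ : c 0F ≢ c 1F) (central : ∀ k → IsCentral G (c k))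
  (s : Fin n → ℕ) (2≤s : ∀ i → 2 ≤ s i) (occupied : ∀ k → ∃ λ u → u ∈ NL G c k) where

  open Centres G tree diam

  adjacent : Adj G (c 0F) (c 1F)
  adjacent = centres-adjacent c≢ (central⇒short (central 0F)) (central⇒short (central 1F))

  bridged : ∀ k → Adj G (c k) (c (opposite k))
  bridged 0F = adjacent
  bridged 1F = sym G adjacent

  open Broom G (proj₂ tree) trail c bridged (λ k → central⇒short (central k))

  private
    leaf? : ∀ v → Dec (∣ neighbours G v ∣ ≡ 1)
    leaf? v = ∣ neighbours G v ∣ ℕ.≟ 1

  -- The number of neighbours of `u` is not 1 and `c k` is one of them, so `another` supplies a
  -- second.
  NL⇒inner : ∀ {k u} → u ∈ NL G c k → Located k inner u
  NL⇒inner {k} {u} u∈ = let w , w∈ , w≢ = second in inner e u≢ (∈-tabulate⁻ (adj? G u) w∈) w≢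
    where
    near : u ∈ neighbours G (c k) - c (opposite k)
    near = Subsetₚ.p─q⊆p _ (leaves G) u∈
    e : Adj G (c k) u
    e = ∈-tabulate⁻ (adj? G (c k)) (Subsetₚ.p─q⊆p _ ⁅ c (opposite k) ⁆ near)
    u≢ : u ≢ c (opposite k)
    u≢ refl = ∈─⇒∉ (neighbours G (c k)) ⁅ c (opposite k) ⁆ near (Subsetₚ.x∈⁅x⁆ _)
    second : ∃ λ w → w ∈ neighbours G u × w ≢ c k
    second = another (∈-tabulate⁺ (adj? G u) (sym G e))
      (λ one → ∈─⇒∉ (neighbours G (c k) - c (opposite k)) (leaves G) u∈ (∈-tabulate⁺ leaf? one))

  inner⇒NL : ∀ {k u} → Located k inner u → u ∈ NL G c k
  inner⇒NL {k} {u} (inner e u≢ f w≢) = Subsetₚ.x∈p∧x∉q⇒x∈p─q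
    (Subsetₚ.x∈p∧x≢y⇒x∈p-y (∈-tabulate⁺ (adj? G (c k)) e) u≢)
    (λ leaf → w≢ (singleton-≡ (∈-tabulate⁻ leaf? leaf)
       (∈-tabulate⁺ (adj? G u) f) (∈-tabulate⁺ (adj? G u) (sym G e))))

  private
    V = Σ (Fin n) λ i → Fin (s i)

    first : ∀ i → Fin (s i)
    first i = fromℕ< (ℕₚ.≤-trans (s≤s z≤n) (2≤s i))

  project : {D : Orientation (G ⟨ s ⟩)} → ∀ {k x y} → Walk (Arc D) k x y →
    Walk (Adj G) k (proj₁ x) (proj₁ y)
  project {D} = Geodesics.project G (proj₂ tree) s (Arc D) (λ e → proj₂ (arc⇒adj D e))

  inClass : (Σ (Orientation (G ⟨ s ⟩)) λ D → Within5 (Arc D)) → InClass 0 G s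
  inClass (D , close) with proj₂ diam
  ... | a , b , (_ , 5≤) = 5 , diam , (D , strong , distances , antipodes) , minimal
    where
    _≟ⱽ_ : (x y : V) → Dec (x ≡ y)
    _≟ⱽ_ = Prodₚ.≡-dec Fin._≟_ Fin._≟_
    any? : ∀ {P : V → Set} → (∀ v → Dec (P v)) → Dec (∃ P)
    any? P? with Finₚ.any? (λ i → Finₚ.any? (λ j → P? (i , j)))
    ... | yes (i , j , p) = yes ((i , j) , p)
    ... | no none         = no λ ((i , j) , p) → none (i , j , p)
    distances : ∀ x y → ∃ λ k → Distance (Arc D) x y k × k ≤ 5
    distances x y with close x y
    ... | k , k≤5 , w with distance _≟ⱽ_ (arc? D) any? w
    ...   | l , d , l≤k = l , d , ℕₚ.≤-trans l≤k k≤5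
    strong : Connected (Arc D)
    strong x y with distances x y
    ... | k , (p , _) , _ = k , p
    -- Walks project to the tree, where `a` and `b` are at distance 5. This bounds every orientation
    -- from below and makes 5 an attained distance in `D`.
    far-apart : (D′ : Orientation (G ⟨ s ⟩)) → ∀ {k} →
      Walk (Arc D′) k (a , first a) (b , first b) → 5 ≤ k
    far-apart D′ w with shorten Fin._≟_ (project {D′} w)
    ... | l , l≤k , p = ℕₚ.≤-trans (5≤ l p) l≤k
    antipodes : ∃₂ λ x y → Distance (Arc D) x y 5
    antipodes with distances (a , first a) (b , first b)
    ... | k , d , k≤5 = _ , _ ,
      subst (Distance (Arc D) _ _) (ℕₚ.≤-antisym k≤5 (far-apart D (proj₁ (proj₁ d)))) d
    minimal : ∀ k →
      (Σ (Orientation (G ⟨ s ⟩)) λ D′ → Connected (Arc D′) × IsDiameter (Arc D′) k) → 5 ≤ k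
    minimal k (D′ , _ , d , _) with d (a , first a) (b , first b)
    ... | l , ((w , _) , _) , l≤k = ℕₚ.≤-trans (far-apart D′ w) l≤k

  inhabited : ∀ k → ∃ (Located k inner)
  inhabited k = proj₁ (occupied k) , NL⇒inner (proj₂ (occupied k))

  wide-centre : 3 ≤ s (c 0F) → InClass 0 G s
  wide-centre 3≤ =
    inClass (Colouring.oriented threeCentres s fits inhabited (λ _ ()) threeCentres-rapid)
    where
    fits : ∀ {k p i} → Located k p i → Scheme.width threeCentres k p ≤ s i
    fits {0F} centre          = 3≤
    fits {1F} centre          = 2≤s _
    fits {0F} (inner _ _ _ _) = 2≤s _
    fits {1F} (inner _ _ _ _) = 2≤s _
    fits (pend _ _ _)          = ℕₚ.<⇒≤ (2≤s _)
    fits {0F} (far _ _ _ _)   = ℕₚ.<⇒≤ (2≤s _)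
    fits {1F} (far _ _ _ _)   = ℕₚ.<⇒≤ (2≤s _)

  wide-inner : (∀ k {u} → u ∈ NL G c k → 4 ≤ s u) → InClass 0 G s
  wide-inner 4≤ = inClass (Colouring.oriented wide s fits inhabited (λ _ ()) wide-rapid)
    where
    fits : ∀ {k p i} → Located k p i → Scheme.width wide k p ≤ s i
    fits centre                = 2≤s _
    fits {k} x@(inner _ _ _ _) = 4≤ k (inner⇒NL x)
    fits (pend _ _ _)          = ℕₚ.<⇒≤ (2≤s _)
    fits (far _ _ _ _)         = 2≤s _

  single-inner : ∣ NL G c 0F ∣ ≡ 1 → InClass 0 G s
  single-inner one = inClass (Colouring.oriented narrow s fits inhabited alone narrow-rapid)
    where
    fits : ∀ {k p i} → Located k p i → Scheme.width narrow k p ≤ s i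
    fits {0F} centre          = 2≤s _
    fits {1F} centre          = 2≤s _
    fits {0F} (inner _ _ _ _) = 2≤s _
    fits {1F} (inner _ _ _ _) = 2≤s _
    fits (pend _ _ _)          = ℕₚ.<⇒≤ (2≤s _)
    fits {0F} (far _ _ _ _)   = 2≤s _
    fits {1F} (far _ _ _ _)   = ℕₚ.<⇒≤ (2≤s _)
    alone : ∀ k → True (Scheme.single narrow k) →
      ∀ {u v} → Located k inner u → Located k inner v → u ≡ v
    alone 0F _ x y = singleton-≡ one (inner⇒NL x) (inner⇒NL y)

  arm : ∀ {k u} → u ∈ NL G c k → Σ (Arm G (c k) (c (opposite k))) λ X → hub X ≡ u
  arm u∈ with NL⇒inner u∈
  ... | inner e u≢ f w≢ = record { stem = e ; hub≢ = u≢ ; twig = f ; tip≢ = w≢ } , refl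

  narrow-inner : ∀ {u} → u ∈ NL G c 0F → s u ≤ 3 → s (c 0F) ≡ 2 → s (c 1F) ≡ 2 → InClass 0 G s →
    ∃ λ k → ∣ NL G c k ∣ ≡ 1
  narrow-inner {u} u∈ s≤3 s₀ s₁ (d , diam′ , (D , _ , near , _) , _)
    with ∣ NL G c 0F ∣ ℕ.≟ 1 | ∣ NL G c 1F ∣ ℕ.≟ 1
  ... | yes one | _ = 0F , one
  ... | no _ | yes one = 1F , one
  ... | no ≢₀ | no ≢₁ with another u∈ ≢₀ | another (proj₂ (occupied 1F)) ≢₁
  ...   | u′ , u′∈ , u′≢u | v′ , v′∈ , v′≢v
        with arm u∈ | arm u′∈ | arm (proj₂ (occupied 1F)) | arm v′∈
  ...     | X , refl | X′ , refl | Y , eq | Y′ , refl =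
    ⊥-elim (no-rapid-orientation G (proj₂ tree) s (λ i → ℕₚ.<⇒≤ (2≤s i)) D close′ adjacent s₀ s₁
      X X′ (≢-sym u′≢u) Y Y′ (λ Y≡Y′ → v′≢v (≡.trans (≡.sym Y≡Y′) eq)) s≤3)
    where
    close′ : Within5 (Arc D)
    close′ x y with near x y
    ... | k , ((w , _) , _) , k≤d = k ,
      subst (k ≤_) (≡.trans (ℕₚ.+-identityʳ d) (diameter-unique diam′ diam)) k≤d , w

theorem2p6 : ∀ {n} (T : Graph (Fin n)) → IsTree T → IsDiameter (Adj T) 5 →
    (c : Fin 2 → Fin n) → c 0F ≢ c 1F → (∀ k → IsCentral T (c k)) →
    (s : Fin n → ℕ) → (∀ i → 2 ≤ s i) →
    (m : Fin 2 → ℕ) →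
    (∀ k → IsMinimum (λ a → ∃ λ u → u ∈ NL T c k × a ≡ s u) (m k)) →
    ((∃ λ k → 3 ≤ s (c k)) → InClass 0 T s)
    × (4 ≤ m 0F → 4 ≤ m 1F → InClass 0 T s)
    × (s (c 0F) ≡ 2 → s (c 1F) ≡ 2 → (∃ λ k → 2 ≤ m k × m k ≤ 3) →
    InClass 0 T s ⇔ (∃ λ k → ∣ NL T c k ∣ ≡ 1))
theorem2p6 {n} T tree diam c c≢ central s 2≤s m least-NL =
    (λ where
      (0F , 3≤) → wide-centre 3≤
      (1F , 3≤) → Flipped.wide-centre 3≤)
  , (λ 4≤₀ 4≤₁ → wide-inner λ where
      0F u∈ → ℕₚ.≤-trans 4≤₀ (proj₂ (least-NL 0F) _ (_ , u∈ , refl))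
      1F u∈ → ℕₚ.≤-trans 4≤₁ (proj₂ (least-NL 1F) _ (_ , u∈ , refl)))
  , λ s₀ s₁ small → mk⇔ (onlyIf s₀ s₁ small) λ where
      (0F , one) → single-inner one
      (1F , one) → Flipped.single-inner one
  where
  -- A minimum is attained, which provides a vertex on each side.
  occupied : ∀ k → ∃ λ u → u ∈ NL T c k
  occupied k with least-NL k
  ... | (u , u∈ , _) , _ = u , u∈
  flipped-occupied : ∀ k → ∃ λ u → u ∈ NL T (c ∘ opposite) k
  flipped-occupied 0F = occupied 1F
  flipped-occupied 1F = occupied 0F
  open Classes T tree diam c c≢ central s 2≤s occupied
  -- The constructions for a wide centre and for a single inner vertex, and the obstruction, all
  -- favour side 0; exchanging the centres transfers them to side 1.
  module Flipped =
    Classes T tree diam (c ∘ opposite) (≢-sym c≢) (central ∘ opposite) s 2≤s flipped-occupied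
  onlyIf : s (c 0F) ≡ 2 → s (c 1F) ≡ 2 → (∃ λ k → 2 ≤ m k × m k ≤ 3) →
    InClass 0 T s → ∃ λ k → ∣ NL T c k ∣ ≡ 1
  onlyIf s₀ s₁ (0F , _ , m≤3) inC with proj₁ (least-NL 0F)
  ... | u , u∈ , eq = narrow-inner u∈ (subst (_≤ 3) eq m≤3) s₀ s₁ inC
  onlyIf s₀ s₁ (1F , _ , m≤3) inC with proj₁ (least-NL 1F)
  ... | u , u∈ , eq with Flipped.narrow-inner u∈ (subst (_≤ 3) eq m≤3) s₁ s₀ inC
  ...   | 0F , one = 1F , one
  ...   | 1F , one = 0F , one
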